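{- Let $k\ge 1$ be an integer and let $H$ be a finite chordal graph with clique number $\omega(H) = k+1$. Then $\chi_{\mathrm{g}}^{(k)}(H) \le k+3$.
   Context: The $k$-clique-relaxed $n$-coloring game on a finite graph $G$: there is a fixed set of $n$ colors; Alice moves first, and Alice and Bob alternately choose an uncolored vertex and assign it one of the $n$ colors, subject to the rule that at no point in the game may there be a monochromatic clique on $k+1$ vertices (a color is legal for a vertex if assigning it creates no monochromatic $(k+1)$-clique). Alice wins if the game ends with all vertices colored; Bob wins if at some point an uncolored vertex has no legal color. The $k$-clique-relaxed game chromatic number $\chi_{\mathrm{g}}^{(k)}(G)$ is the least $n$ such that Alice has a winning strategy in this game. A graph is chordal if it has no induced cycle of length at least 4; $\omega(H)$ denotes the clique number. -}

module Defs where

open import Data.Nat using (ℕ; zero; suc; _≤_; _+_; _∸_)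
open import Data.Fin using (Fin; toℕ; _≟_)
open import Data.Maybe using (Maybe; just; nothing)
open import Data.Product using (Σ; ∃; _×_; _,_)
open import Data.Sum using (_⊎_)
open import Relation.Nullary using (¬_; yes; no)
open import Relation.Binary using (Decidable)
open import Relation.Binary.PropositionalEquality using (_≡_; _≢_)
open import Function.Definitions using (Injective)

record Graph (m : ℕ) : Set₁ where
  field
    Adj     : Fin m → Fin m → Set
    adj?    : Decidable Adj
    sym     : ∀ {u v} → Adj u v → Adj v u
    irrefl  : ∀ {v} → ¬ Adj v v

open Graph public

record Clique {m : ℕ} (G : Graph m) (s : ℕ) : Set where
  field
    vert   : Fin s → Fin m
    inj    : Injective _≡_ _≡_ vert
    adjacent : ∀ i j → i ≢ j → Adj G (vert i) (vert j)

open Clique public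

CliqueNumber : {m : ℕ} → Graph m → ℕ → Set
CliqueNumber G c = Clique G c × (∀ s → Clique G s → s ≤ c)

Next : {L : ℕ} → Fin L → Fin L → Set
Next {L} i j = (toℕ j ≡ suc (toℕ i)) ⊎ ((suc (toℕ i) ≡ L) × (toℕ j ≡ 0))

record InducedCycle {m : ℕ} (G : Graph m) (L : ℕ) : Set where
  field
    cyc     : Fin L → Fin m
    inj     : Injective _≡_ _≡_ cyc
    adjIff₁ : ∀ i j → Adj G (cyc i) (cyc j) → Next i j ⊎ Next j i
    adjIff₂ : ∀ i j → Next i j → Adj G (cyc i) (cyc j)

Chordal : {m : ℕ} → Graph m → Set
Chordal G = ∀ L → 4 ≤ L → ¬ InducedCycle G L

Coloring : ℕ → ℕ → Set
Coloring m n = Fin m → Maybe (Fin n)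

update : {m n : ℕ} → Coloring m n → Fin m → Fin n → Coloring m n
update c v a w with w ≟ v
... | yes _ = just a
... | no  _ = c w

MonoClique : {m n : ℕ} → Graph m → ℕ → Coloring m n → Set
MonoClique G k c = Σ (Clique G (suc k)) λ K →
  Σ _ λ a → ∀ i → c (vert K i) ≡ just a

LegalMove : {m n : ℕ} → Graph m → ℕ → Coloring m n → Fin m → Fin n → Set
LegalMove G k c v a = (c v ≡ nothing) × ¬ MonoClique G k (update c v a)

AllColored : {m n : ℕ} → Coloring m n → Set
AllColored c = ∀ v → ¬ (c v ≡ nothing)

-- No uncolored vertex is blocked (otherwise Bob has won).
NoneBlocked : {m n : ℕ} → Graph m → ℕ → Coloring m n → Set
NoneBlocked G k c = ∀ v → c v ≡ nothing → ∃ λ a → LegalMove G k c v a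

data Player : Set where
  alice bob : Player

-- AliceWins G k n p c : from position c with player p to move,
-- Alice has a winning strategy.  (The game is finite: each move colours
-- a vertex, so the inductive definition captures winning strategies.)
data AliceWins {m : ℕ} (G : Graph m) (k n : ℕ) : Player → Coloring m n → Set where
  finished : ∀ {p c} → AllColored c → AliceWins G k n p c
  aliceMove : ∀ {c} → NoneBlocked G k c →
              (v : Fin m) (a : Fin n) → LegalMove G k c v a →
              AliceWins G k n bob (update c v a) →
              AliceWins G k n alice c
  bobMove : ∀ {c} → NoneBlocked G k c →
            (∀ v a → LegalMove G k c v a →
               AliceWins G k n alice (update c v a)) →
            AliceWins G k n bob c

emptyColoring : {m n : ℕ} → Coloring m n
emptyColoring _ = nothing

AliceWinsGame : {m : ℕ} → Graph m → ℕ → ℕ → Set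
AliceWinsGame G k n = AliceWins G k n alice emptyColoring

-- χ_g^(k)(G) ≤ b : the least n for which Alice wins is at most b,
-- i.e. Alice wins with some n ≤ b colors.
GameChromLe : {m : ℕ} → Graph m → ℕ → ℕ → Set
GameChromLe G k b = ∃ λ n → (n ≤ b) × AliceWinsGame G k n

{-# OPTIONS --safe #-}

-- Dirac: every nonempty induced subgraph of a chordal graph has a simplicial
-- vertex, so the vertices can be ranked such that the lower-ranked neighbours
-- of each vertex form a clique.  Call v the parent of u if v is the
-- lowest-ranked of the lower-ranked neighbours of u; this gives a rooted forest.
--
-- Alice plays the activation strategy on this forest: after Bob colours x she
-- climbs from x towards the root, activating vertices, and colours the first
-- one that was already active (or, failing that, any uncoloured vertex without
-- an uncoloured parent).  Hence on her turn an uncoloured v has at most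
-- two active children.  If a colour a is illegal for v, then v completes an
-- a-coloured (k+1)-clique K.  Either K contains a lower-ranked neighbour of v,
-- of which there are at most k, or v is the lowest vertex of K; then v is the
-- parent of the highest vertex of K, since a still lower neighbour would be
-- adjacent to all of K.  So at most k + 2 colours are illegal for v.

module Submission where

open import Defs
open import Data.Empty using (⊥; ⊥-elim)
open import Data.Fin using (Fin; zero; suc; toℕ; punchIn)
open import Data.Fin.Properties using (_≟_; any?; all?; punchIn-injective; punchInᵢ≢i)
open import Data.List using (List; []; _∷_; length; lookup; filter; allFin)
open import Data.List.Membership.Propositional using (_∈_; _∉_; lose; find)
open import Data.List.Membership.Propositional.Properties using (∈-filter⁺; ∈-filter⁻; ∈-allFin; ∈-lookup)
open import Data.List.Properties using (filter-notAll)
open import Data.List.Relation.Unary.Any using (Any; here; there; tail) renaming (any? to anyL?)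
open import Data.Maybe using (Maybe; just; nothing)
open import Data.Maybe.Properties using (just-injective; ≡-dec)
open import Data.Nat using (ℕ; zero; suc; _≤_; _<_; _+_; z≤n; s≤s)
open import Data.Nat.Induction using (<-wellFounded)
open import Data.Nat.Properties using (≤-refl; ≤-trans; ≤-reflexive; <-irrefl; <-trans; ≮⇒≥; ≤∧≢⇒<; ≤-total; _<?_; _≤?_; +-comm)
import Data.Nat.Properties as ℕ
open import Data.Product using (∃; _×_; _,_; proj₁; proj₂)
open import Data.Sum using (_⊎_; inj₁; inj₂; swap)
open import Function using (_∘_)
open import Function.Definitions using (Injective)
open import Induction.WellFounded using (Acc; acc)
open import Relation.Binary.Construct.Closure.ReflexiveTransitive using (Star; ε; _◅_; map; reverse)
open import Relation.Binary.PropositionalEquality using (_≡_; _≢_; refl; cong; trans; subst) renaming (sym to ≡-sym)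
open import Relation.Nullary using (¬_; Dec; yes; no)
open import Relation.Nullary.Decidable using (_×-dec_; _⊎-dec_; _→-dec_; ¬?)

-- Induced paths and the induced cycles they close up to.

module InducedPaths {m : ℕ} (G : Graph m) where

  V : Set
  V = Fin m

  -- The side condition of `cons` ranges over the path beyond `b`, so `a` meets the rest only
  -- through the edge to `b`.
  data InducedPath : V → V → List V → Set where
    single : ∀ {a} → InducedPath a a (a ∷ [])
    cons   : ∀ {a b e l} → Adj G a b → (∀ {w} → w ∈ l → ¬ (a ≡ w ⊎ Adj G a w)) →
             InducedPath b e (b ∷ l) → InducedPath a e (a ∷ b ∷ l)

  private
    Touches : V → V → Set
    Touches x w = x ≡ w ⊎ Adj G x w

    touches? : ∀ x l → Dec (Any (Touches x) l)
    touches? x = anyL? (λ w → (x ≟ w) ⊎-dec adj? G x w)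

  -- Start at the last vertex of the path that `x` equals or is adjacent to and drop everything
  -- before it. Nothing later touches `x`, so the shortened path stays induced.
  prepend : ∀ {p e l} x → InducedPath p e l → Any (Touches x) l →
            ∃ λ l′ → InducedPath x e l′ × (∀ {z} → z ∈ l′ → z ≡ x ⊎ z ∈ l)
  prepend x single (here (inj₁ refl)) = _ , single , λ { (here q) → inj₁ q }
  prepend x single (here (inj₂ a)) =
    _ , cons a (λ ()) single , λ { (here q) → inj₁ q ; (there z∈) → inj₂ z∈ }
  prepend x (cons {b = b} {l = l} a n P) t with touches? x (b ∷ l)
  ... | yes t′ with prepend x P t′
  ...   | l′ , P′ , sub = l′ , P′ , λ z∈ → weaken (sub z∈)
    where
    weaken : ∀ {z y w l} → z ≡ y ⊎ z ∈ l → z ≡ y ⊎ z ∈ (w ∷ l)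
    weaken (inj₁ q)  = inj₁ q
    weaken (inj₂ z∈) = inj₂ (there z∈)
  prepend x (cons a n P) (here (inj₁ refl)) | no _ = _ , cons a n P , inj₂
  prepend x (cons a n P) (here (inj₂ x~a)) | no ¬t =
    _ , cons x~a (λ w∈ t → ¬t (lose w∈ t)) (cons a n P)
      , λ { (here q) → inj₁ q ; (there z∈) → inj₂ z∈ }
  prepend x (cons a n P) (there t) | no ¬t = ⊥-elim (¬t t)

  head∈ : ∀ {a e l} → InducedPath a e l → a ∈ l
  head∈ single       = here refl
  head∈ (cons _ _ _) = here refl

  -- Prepending the vertices of the walk from its far end stands in for choosing a shortest walk:
  -- `prepend` cuts shortcuts and adds no vertex from outside the walk, so `Q` survives.
  fromWalk : ∀ {Q : V → Set} {a e} → Q a → Star (λ b c → Adj G b c × Q c) a e →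
             ∃ λ l → InducedPath a e l × (∀ {z} → z ∈ l → Q z)
  fromWalk qa ε = _ , single , λ { (here refl) → qa }
  fromWalk {Q} {a} qa ((a~b , qb) ◅ w) with fromWalk qb w
  ... | l , P , all with prepend a P (lose (head∈ P) (inj₂ a~b))
  ...   | l′ , P′ , sub = l′ , P′ , λ z∈ → restrict (sub z∈)
    where
    restrict : ∀ {z} → z ≡ a ⊎ z ∈ l → Q z
    restrict (inj₁ refl) = qa
    restrict (inj₂ z∈)   = all z∈

  path-injective : ∀ {a e l} → InducedPath a e l → Injective _≡_ _≡_ (lookup l)
  path-injective single {zero} {zero} _ = refl
  path-injective (cons x n P) {zero} {zero} _ = refl
  path-injective (cons x n P) {zero} {suc zero} q = ⊥-elim (irrefl G (subst (Adj G _) (≡-sym q) x))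
  path-injective (cons x n P) {zero} {suc (suc j)} q = ⊥-elim (n (∈-lookup j) (inj₁ q))
  path-injective (cons x n P) {suc zero} {zero} q = ⊥-elim (irrefl G (subst (Adj G _) q x))
  path-injective (cons x n P) {suc (suc i)} {zero} q = ⊥-elim (n (∈-lookup i) (inj₁ (≡-sym q)))
  path-injective (cons x n P) {suc i} {suc j} q = cong suc (path-injective P q)

  path-chordless : ∀ {a e l} → InducedPath a e l → ∀ i j → Adj G (lookup l i) (lookup l j) →
                   toℕ j ≡ suc (toℕ i) ⊎ toℕ i ≡ suc (toℕ j)
  path-chordless single zero zero q = ⊥-elim (irrefl G q)
  path-chordless (cons x n P) zero zero q = ⊥-elim (irrefl G q)
  path-chordless (cons x n P) zero (suc zero) q = inj₁ refl
  path-chordless (cons x n P) zero (suc (suc j)) q = ⊥-elim (n (∈-lookup j) (inj₂ q))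
  path-chordless (cons x n P) (suc zero) zero q = inj₂ refl
  path-chordless (cons x n P) (suc (suc i)) zero q = ⊥-elim (n (∈-lookup i) (inj₂ (sym G q)))
  path-chordless (cons x n P) (suc i) (suc j) q with path-chordless P i j q
  ... | inj₁ e = inj₁ (cong suc e)
  ... | inj₂ e = inj₂ (cong suc e)

  path-adjacent : ∀ {a e l} → InducedPath a e l → ∀ i j → toℕ j ≡ suc (toℕ i) →
                  Adj G (lookup l i) (lookup l j)
  path-adjacent single zero zero ()
  path-adjacent (cons x n P) zero (suc zero) q = x
  path-adjacent (cons x n P) (suc i) (suc j) q = path-adjacent P i j (ℕ.suc-injective q)

  path-first : ∀ {a e l} → InducedPath a e l → ∀ i → toℕ i ≡ 0 → lookup l i ≡ a
  path-first single zero _       = refl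
  path-first (cons _ _ _) zero _ = refl

  path-last : ∀ {a e l} → InducedPath a e l → ∀ i → suc (toℕ i) ≡ length l → lookup l i ≡ e
  path-last single zero _ = refl
  path-last (cons _ _ P) (suc i) q = path-last P i (ℕ.suc-injective q)

  path-firstIndex : ∀ {a e l} → InducedPath a e l → ∃ λ (i : Fin (length l)) → toℕ i ≡ 0
  path-firstIndex single       = zero , refl
  path-firstIndex (cons _ _ _) = zero , refl

  path-lastIndex : ∀ {a e l} → InducedPath a e l → ∃ λ (i : Fin (length l)) → suc (toℕ i) ≡ length l
  path-lastIndex single = zero , refl
  path-lastIndex (cons _ _ P) with path-lastIndex P
  ... | i , q = suc i , cong suc q

  path-long : ∀ {a e l} → InducedPath a e l → a ≢ e → ¬ Adj G a e → 3 ≤ length l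
  path-long single a≢e _ = ⊥-elim (a≢e refl)
  path-long (cons a~e _ single) _ a≁e = ⊥-elim (a≁e a~e)
  path-long (cons _ _ (cons _ _ _)) _ _ = s≤s (s≤s (s≤s z≤n))

  -- `r` takes index 0 and the path follows, so the wraparound in `Next` is the edge from `y` back
  -- to `r`. Since `r` sees only the two ends, no chord arises.
  closePath : ∀ {x y l} r → InducedPath x y l → Adj G r x → Adj G r y →
              (∀ {z} → z ∈ l → z ≡ x ⊎ z ≡ y ⊎ (z ≢ r × ¬ Adj G r z)) →
              InducedCycle G (suc (length l))
  closePath {x} {y} {l} r P r~x r~y interior = record
    { cyc = lookup (r ∷ l) ; inj = inj′ ; adjIff₁ = adj→next ; adjIff₂ = next→adj }
    where
    avoids : ∀ {z} → z ∈ l → z ≢ r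
    avoids z∈ q with interior z∈
    ... | inj₁ refl = irrefl G (subst (Adj G r) q r~x)
    ... | inj₂ (inj₁ refl) = irrefl G (subst (Adj G r) q r~y)
    ... | inj₂ (inj₂ (z≢r , _)) = z≢r q

    endpoint : ∀ i → Adj G r (lookup l i) → toℕ i ≡ 0 ⊎ suc (toℕ i) ≡ length l
    endpoint i r~i with interior (∈-lookup i)
    ... | inj₁ q with path-firstIndex P
    ...   | j , j0 = inj₁ (trans (cong toℕ (path-injective P (trans q (≡-sym (path-first P j j0))))) j0)
    endpoint i r~i | inj₂ (inj₁ q) with path-lastIndex P
    ...   | j , jl = inj₂ (trans (cong (suc ∘ toℕ) (path-injective P (trans q (≡-sym (path-last P j jl))))) jl)
    endpoint i r~i | inj₂ (inj₂ (_ , r≁i)) = ⊥-elim (r≁i r~i)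

    inj′ : Injective _≡_ _≡_ (lookup (r ∷ l))
    inj′ {zero} {zero} _ = refl
    inj′ {zero} {suc j} q = ⊥-elim (avoids (∈-lookup j) (≡-sym q))
    inj′ {suc i} {zero} q = ⊥-elim (avoids (∈-lookup i) q)
    inj′ {suc i} {suc j} q = cong suc (path-injective P q)

    root-next : ∀ i → Adj G r (lookup l i) → Next zero (suc i) ⊎ Next (suc i) zero
    root-next i r~i with endpoint i r~i
    ... | inj₁ q = inj₁ (inj₁ (cong suc q))
    ... | inj₂ q = inj₂ (inj₂ (cong suc q , refl))

    adj→next : ∀ i j → Adj G (lookup (r ∷ l) i) (lookup (r ∷ l) j) → Next i j ⊎ Next j i
    adj→next zero zero q = ⊥-elim (irrefl G q)
    adj→next zero (suc j) q = root-next j q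
    adj→next (suc i) zero q = swap (root-next i (sym G q))
    adj→next (suc i) (suc j) q with path-chordless P i j q
    ... | inj₁ e = inj₁ (inj₁ (cong suc e))
    ... | inj₂ e = inj₂ (inj₁ (cong suc e))

    next→adj : ∀ i j → Next i j → Adj G (lookup (r ∷ l) i) (lookup (r ∷ l) j)
    next→adj zero (suc j) (inj₁ q) =
      subst (Adj G r) (≡-sym (path-first P j (ℕ.suc-injective q))) r~x
    next→adj zero zero (inj₂ (q , _)) with length l | ℕ.suc-injective q | path-firstIndex P
    ... | zero | _ | () , _
    next→adj (suc i) (suc j) (inj₁ q) = path-adjacent P i j (ℕ.suc-injective q)
    next→adj (suc i) zero (inj₂ (q , _)) =
      subst (λ z → Adj G z r) (≡-sym (path-last P i (ℕ.suc-injective q))) (sym G r~y)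

-- Simplicial vertices of chordal graphs (Dirac).

module Elimination {m : ℕ} (G : Graph m) (chordal : Chordal G) where

  open InducedPaths G
  open import Data.List.Membership.DecPropositional (_≟_ {m}) using (_∈?_)

  Simplicial : List V → V → Set
  Simplicial U x = ∀ {y z} → y ∈ U → z ∈ U → Adj G x y → Adj G x z → y ≢ z → Adj G y z

  StepIn : List V → V → V → Set
  StepIn S a b = Adj G a b × a ∈ S × b ∈ S

  Connected : List V → Set
  Connected S = ∀ {a b} → a ∈ S → b ∈ S → Star (StepIn S) a b

  HasNeighbourIn : List V → V → Set
  HasNeighbourIn S x = Any (Adj G x) S

  Dominated : List V → V → Set
  Dominated S x = x ∈ S ⊎ HasNeighbourIn S x

  dominated? : ∀ S x → Dec (Dominated S x)
  dominated? S x = (x ∈? S) ⊎-dec anyL? (adj? G x) S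

  connected-∷ : ∀ {x S} → HasNeighbourIn S x → Connected S → Connected (x ∷ S)
  connected-∷ {x} {S} nx conn = conn′
    where
    grow : ∀ {a b} → StepIn S a b → StepIn (x ∷ S) a b
    grow (a~b , a∈ , b∈) = a~b , there a∈ , there b∈

    from-x : ∀ {b} → b ∈ S → Star (StepIn (x ∷ S)) x b
    from-x b∈ with find nx
    ... | s , s∈ , x~s = (x~s , here refl , there s∈) ◅ map grow (conn s∈ b∈)

    conn′ : Connected (x ∷ S)
    conn′ (here refl) (here refl) = ε
    conn′ (here refl) (there b∈)  = from-x b∈
    conn′ (there a∈)  (here refl) = reverse (λ { (p , a∈ , b∈) → sym G p , b∈ , a∈ }) (from-x a∈)
    conn′ (there a∈)  (there b∈)  = map grow (conn a∈ b∈)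

  -- Otherwise r together with a shortest path from x to y through S would be
  -- an induced cycle of length at least four.
  boundary-adjacent : ∀ {S r x y} → Connected S → ¬ Dominated S r →
                      HasNeighbourIn S x → HasNeighbourIn S y →
                      Adj G r x → Adj G r y → x ≢ y → Adj G x y
  boundary-adjacent {S} {r} {x} {y} conn r∉N nx ny r~x r~y x≢y with adj? G x y
  ... | yes x~y = x~y
  ... | no x≁y with find nx | find ny
  ...   | s , s∈ , x~s | t , t∈ , y~t = ⊥-elim contra
    where
    Q : V → Set
    Q z = z ≡ x ⊎ z ≡ y ⊎ z ∈ S

    to-y : ∀ {s} → Star (StepIn S) s t → Star (λ b c → Adj G b c × Q c) s y
    to-y ε = (sym G y~t , inj₂ (inj₁ refl)) ◅ ε
    to-y ((p , _ , b∈) ◅ w) = (p , inj₂ (inj₂ b∈)) ◅ to-y w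

    contra : ⊥
    contra with fromWalk {Q = Q} (inj₁ refl) ((x~s , inj₂ (inj₂ s∈)) ◅ to-y (conn s∈ t∈))
    ... | l , P , all = chordal _ (s≤s (path-long P x≢y x≁y)) (closePath r P r~x r~y (λ z∈ → outside (all z∈)))
      where
      outside : ∀ {z} → Q z → z ≡ x ⊎ z ≡ y ⊎ (z ≢ r × ¬ Adj G r z)
      outside (inj₁ q) = inj₁ q
      outside (inj₂ (inj₁ q)) = inj₂ (inj₁ q)
      outside (inj₂ (inj₂ z∈)) =
        inj₂ (inj₂ ((λ { refl → r∉N (inj₁ z∈) }) , λ r~z → r∉N (inj₂ (lose z∈ r~z))))

  undominated : List V → List V → List V
  undominated S U = filter (λ x → ¬? (dominated? S x)) U

  -- The last component keeps `r` undominated after `x` joins `S`, so the enlarged set still fails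
  -- to dominate `U`.
  Absorbable : List V → List V → V → Set
  Absorbable U S x = x ∈ U × x ∉ S × HasNeighbourIn S x ×
                     ∃ λ r → r ∈ U × ¬ Dominated S r × ¬ Adj G r x

  absorbable? : ∀ U S x → Dec (Absorbable U S x)
  absorbable? U S x = (x ∈? U) ×-dec ¬? (x ∈? S) ×-dec anyL? (adj? G x) S ×-dec
    any? (λ r → (r ∈? U) ×-dec ¬? (dominated? S r) ×-dec ¬? (adj? G r x))

  -- For the induction on `U`: `base` makes `undominated S U` strictly shorter than `U`, and `rest`
  -- makes it nonempty.
  record Maximal (U : List V) : Set where
    field
      S         : List V
      connected : Connected S
      base      : V
      base∈S    : base ∈ S
      base∈U    : base ∈ U
      rest      : V
      rest∈U    : rest ∈ U
      rest∉N    : ¬ Dominated S rest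
      maximal   : ∀ x → ¬ Absorbable U S x

  -- `T` lists at least the vertices outside `S`. Each absorbed vertex is removed from it, so its
  -- length is the termination measure.
  grow : ∀ {U} S T → Acc _<_ (length T) → (∀ {z} → z ∉ S → z ∈ T) → Connected S →
         ∀ {v r} → v ∈ S → v ∈ U → r ∈ U → ¬ Dominated S r → Maximal U
  grow {U} S T (acc rec) covers conn {v} {r} v∈S v∈U r∈U r∉N with any? (absorbable? U S)
  ... | no none = record
    { S = S ; connected = conn ; base∈S = v∈S ; base∈U = v∈U ; rest∈U = r∈U ; rest∉N = r∉N
    ; maximal = λ x q → none (x , q) }
  ... | yes (x , x∈U , x∉S , nx , r′ , r′∈U , r′∉N , r′≁x) =
    grow (x ∷ S) (filter other? T) (rec (filter-notAll other? T (lose (covers x∉S) (λ x≢x → x≢x refl))))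
      (λ z∉ → ∈-filter⁺ other? (covers (z∉ ∘ there)) (z∉ ∘ here))
      (connected-∷ nx conn) (there v∈S) v∈U r′∈U undom
    where
    other? : ∀ z → Dec (z ≢ x)
    other? z = ¬? (z ≟ x)
    undom : ¬ Dominated (x ∷ S) r′
    undom (inj₁ (here refl)) = r′∉N (inj₂ nx)
    undom (inj₁ (there r∈))  = r′∉N (inj₁ r∈)
    undom (inj₂ (here q))    = r′≁x q
    undom (inj₂ (there q))   = r′∉N (inj₂ q)

  NonEdgeIn : List V → V → V → Set
  NonEdgeIn U v r = v ∈ U × r ∈ U × v ≢ r × ¬ Adj G v r

  nonEdgeIn? : ∀ U v r → Dec (NonEdgeIn U v r)
  nonEdgeIn? U v r = (v ∈? U) ×-dec (r ∈? U) ×-dec ¬? (v ≟ r) ×-dec ¬? (adj? G v r)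

  maximalFromNonEdge : ∀ {U v r} → NonEdgeIn U v r → Maximal U
  maximalFromNonEdge {U} {v} {r} (v∈ , r∈ , v≢r , v≁r) =
    grow (v ∷ []) (allFin m) (<-wellFounded _) (λ _ → ∈-allFin _)
      (λ { (here refl) (here refl) → ε }) (here refl) v∈ r∈
      λ { (inj₁ (here refl)) → v≢r refl ; (inj₂ (here r~v)) → v≁r (sym G r~v) }

  -- By maximality, the boundary of S is completely joined to the rest.
  simplicial-lift : ∀ {U x} (M : Maximal U) → let open Maximal M in
                    x ∈ undominated S U → Simplicial (undominated S U) x → Simplicial U x
  simplicial-lift {U} {x} M x∈R simp = simp′
    where
    open Maximal M

    R? : ∀ z → Dec (¬ Dominated S z)
    R? z = ¬? (dominated? S z)

    x∉N = proj₂ (∈-filter⁻ R? {xs = U} x∈R)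

    classify : ∀ {y} → y ∈ U → Adj G x y → y ∈ undominated S U ⊎ (y ∉ S × HasNeighbourIn S y)
    classify {y} y∈ x~y with y ∈? S
    ... | yes y∈S = ⊥-elim (x∉N (inj₂ (lose y∈S x~y)))
    ... | no y∉S with anyL? (adj? G y) S
    ...   | yes ny = inj₂ (y∉S , ny)
    ...   | no ¬ny = inj₁ (∈-filter⁺ R? y∈ λ { (inj₁ q) → y∉S q ; (inj₂ q) → ¬ny q })

    joined : ∀ {y z} → y ∈ undominated S U → z ∈ U → z ∉ S → HasNeighbourIn S z → Adj G y z
    joined {y} {z} y∈ z∈ z∉S nz with adj? G y z
    ... | yes q = q
    -- Otherwise `z` could be absorbed, with `y` as the vertex that stays undominated.
    ... | no ¬q with ∈-filter⁻ R? {xs = U} y∈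
    ...   | y∈U , y∉N = ⊥-elim (maximal z (z∈ , z∉S , nz , y , y∈U , y∉N , ¬q))

    simp′ : Simplicial U x
    simp′ y∈ z∈ x~y x~z y≢z with classify y∈ x~y | classify z∈ x~z
    ... | inj₁ y∈R | inj₁ z∈R = simp y∈R z∈R x~y x~z y≢z
    ... | inj₁ y∈R | inj₂ (z∉ , nz) = joined y∈R z∈ z∉ nz
    ... | inj₂ (y∉ , ny) | inj₁ z∈R = sym G (joined z∈R y∈ y∉ ny)
    ... | inj₂ (_ , ny) | inj₂ (_ , nz) = boundary-adjacent connected x∉N ny nz x~y x~z y≢z

  -- If `U` is complete, any vertex will do. Otherwise a non-edge yields a maximal connected `S`,
  -- and a simplicial vertex of the undominated part, given by induction, is simplicial in all of
  -- `U`.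
  simplicial-exists : ∀ U → Acc _<_ (length U) → ∀ {u} → u ∈ U → ∃ λ x → x ∈ U × Simplicial U x
  simplicial-exists U (acc rec) {u} u∈ with any? (λ v → any? (nonEdgeIn? U v))
  ... | no complete = u , u∈ , λ {y} {z} y∈ z∈ _ _ y≢z → adj y∈ z∈ y≢z
    where
    adj : ∀ {y z} → y ∈ U → z ∈ U → y ≢ z → Adj G y z
    adj {y} {z} y∈ z∈ y≢z with adj? G y z
    ... | yes q = q
    ... | no ¬q = ⊥-elim (complete (y , z , y∈ , z∈ , y≢z , ¬q))
  ... | yes (v , r , ne) with maximalFromNonEdge ne
  ...   | M with simplicial-exists (undominated S U)
                   (rec (filter-notAll _ U (lose base∈U (λ ¬dom → ¬dom (inj₁ base∈S)))))
                   (∈-filter⁺ _ rest∈U rest∉N)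
    where open Maximal M
  ...     | x , x∈R , simp = x , proj₁ (∈-filter⁻ _ {xs = U} x∈R) , simplicial-lift M x∈R simp

  -- Perfect elimination orderings.

  record Ranking (U : List V) : Set where
    field
      rank     : V → ℕ
      bound    : ℕ
      bounded  : ∀ {u} → u ∈ U → rank u < bound
      distinct : ∀ {u w} → u ∈ U → w ∈ U → rank u ≡ rank w → u ≡ w
      lower-clique : ∀ {v u w} → v ∈ U → u ∈ U → w ∈ U → Adj G v u → Adj G v w →
                     rank u < rank v → rank w < rank v → u ≢ w → Adj G u w

  -- The simplicial `x` goes on top, with rank `bound`: its own lower neighbours form a clique, and
  -- it is a lower neighbour of no vertex of `U`.
  ranking-extend : ∀ U x → Simplicial U x → Ranking (filter (λ z → ¬? (z ≟ x)) U) → Ranking U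
  ranking-extend U x simp K = record
    { rank = rank′ ; bound = suc bound ; bounded = bounded′ ; distinct = distinct′ ; lower-clique = lower }
    where
    open Ranking K
    rank′ : V → ℕ
    rank′ z with z ≟ x
    ... | yes _ = bound
    ... | no _  = rank z

    keep : ∀ {z} → z ∈ U → z ≢ x → z ∈ filter (λ z → ¬? (z ≟ x)) U
    keep = ∈-filter⁺ _

    bounded′ : ∀ {u} → u ∈ U → rank′ u < suc bound
    bounded′ {u} u∈ with u ≟ x
    ... | yes _ = ≤-refl
    ... | no n  = <-trans (bounded (keep u∈ n)) ≤-refl

    distinct′ : ∀ {u w} → u ∈ U → w ∈ U → rank′ u ≡ rank′ w → u ≡ w
    distinct′ {u} {w} u∈ w∈ q with u ≟ x | w ≟ x
    ... | yes refl | yes refl = refl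
    ... | yes _ | no n = ⊥-elim (<-irrefl (≡-sym q) (bounded (keep w∈ n)))
    ... | no n | yes _ = ⊥-elim (<-irrefl q (bounded (keep u∈ n)))
    ... | no n | no n′ = distinct (keep u∈ n) (keep w∈ n′) q

    lower : ∀ {v u w} → v ∈ U → u ∈ U → w ∈ U → Adj G v u → Adj G v w →
            rank′ u < rank′ v → rank′ w < rank′ v → u ≢ w → Adj G u w
    lower {v} {u} {w} v∈ u∈ w∈ v~u v~w lu lw u≢w with v ≟ x | u ≟ x | w ≟ x
    ... | yes refl | _ | _ = simp u∈ w∈ v~u v~w u≢w
    ... | no n | yes _ | _ = ⊥-elim (<-irrefl refl (<-trans lu (bounded (keep v∈ n))))
    ... | no n | no _ | yes _ = ⊥-elim (<-irrefl refl (<-trans lw (bounded (keep v∈ n))))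
    ... | no n | no n₁ | no n₂ =
      lower-clique (keep v∈ n) (keep u∈ n₁) (keep w∈ n₂) v~u v~w lu lw u≢w

  ranking : ∀ U → Acc _<_ (length U) → Ranking U
  ranking [] _ = record
    { rank = λ _ → 0 ; bound = 0 ; bounded = λ () ; distinct = λ () ; lower-clique = λ () }
  ranking U@(_ ∷ _) (acc rec) with simplicial-exists U (<-wellFounded _) (here refl)
  ... | x , x∈ , simp =
    ranking-extend U x simp
      (ranking _ (rec (filter-notAll (λ z → ¬? (z ≟ x)) U (lose x∈ (λ x≢x → x≢x refl)))))

-- Finite selection, and basic facts on colourings and cliques.

choose : ∀ {n} {Q P : Fin n → Set} → (∀ a → Q a ⊎ P a) → (∀ a → Q a) ⊎ ∃ P
choose {zero} f = inj₁ λ ()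
choose {suc n} f with f zero | choose (f ∘ suc)
... | inj₂ p | _ = inj₂ (zero , p)
... | inj₁ _ | inj₂ (a , p) = inj₂ (suc a , p)
... | inj₁ q | inj₁ qs = inj₁ λ { zero → q ; (suc a) → qs a }

-- If the first alternative never fails, the discarded element is arbitrary.
discard-one : ∀ {n} {Q P : Fin (suc n) → Set} → (∀ a → Q a ⊎ P a) →
              ∃ λ a₀ → ∀ b → Q (punchIn a₀ b) ⊎ (P (punchIn a₀ b) × P a₀)
discard-one f with choose f
... | inj₁ qs = zero , λ b → inj₁ (qs (punchIn zero b))
... | inj₂ (a₀ , p₀) = a₀ , λ b → mark (f (punchIn a₀ b))
  where
  mark : ∀ {A B : Set} → A ⊎ B → A ⊎ (B × _)
  mark (inj₁ q) = inj₁ q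
  mark (inj₂ p) = inj₂ (p , p₀)

-- Discard two indices. Should `Q` still fail to be offered at a remaining one, then `P` holds there
-- and at both discarded ones, which `few` forbids.
select : ∀ {n} {Q P : Fin (2 + n) → Set} → (∀ a → Q a ⊎ P a) →
         (∀ a b d → a ≢ b → a ≢ d → b ≢ d → P a → P b → P d → ⊥) →
         ∃ λ (e : Fin n → Fin (2 + n)) → Injective _≡_ _≡_ e × (∀ i → Q (e i))
select {n} {Q} f few with discard-one f
... | a₀ , g with discard-one g
...   | b₀ , h = e , (λ p → punchIn-injective b₀ _ _ (punchIn-injective a₀ _ _ p)) , good
  where
  e : Fin n → Fin (2 + n)
  e i = punchIn a₀ (punchIn b₀ i)
  good : ∀ i → Q (e i)
  good i with h i
  ... | inj₁ q = q
  ... | inj₂ ((pe , pa) , (pb , _)) = ⊥-elim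
    (few a₀ (punchIn a₀ b₀) (e i)
      (punchInᵢ≢i a₀ b₀ ∘ ≡-sym) (punchInᵢ≢i a₀ (punchIn b₀ i) ∘ ≡-sym)
      (λ q → punchInᵢ≢i b₀ i (≡-sym (punchIn-injective a₀ _ _ q))) pa pb pe)

argmax : ∀ {n} (f : Fin (suc n) → ℕ) → ∃ λ i → ∀ j → f j ≤ f i
argmax {zero} f = zero , λ { zero → ≤-refl }
argmax {suc n} f with argmax (f ∘ suc)
... | i , max with ≤-total (f zero) (f (suc i))
...   | inj₁ 0≤i = suc i , λ { zero → 0≤i ; (suc j) → max j }
...   | inj₂ i≤0 = zero , λ { zero → ≤-refl ; (suc j) → ≤-trans (max j) i≤0 }

module _ {m n : ℕ} (c : Coloring m n) (v : Fin m) (a : Fin n) where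

  update-same : update c v a v ≡ just a
  update-same with v ≟ v
  ... | yes _ = refl
  ... | no n  = ⊥-elim (n refl)

  update-other : ∀ {w} → w ≢ v → update c v a w ≡ c w
  update-other {w} w≢v with w ≟ v
  ... | yes q = ⊥-elim (w≢v q)
  ... | no _  = refl

  update-uncolored : ∀ {w} → update c v a w ≡ nothing → w ≢ v × c w ≡ nothing
  update-uncolored {w} q with w ≟ v
  update-uncolored () | yes _
  ... | no n = n , q

extend-clique : ∀ {m s} {G : Graph m} (K : Clique G s) w → (∀ i → Adj G w (vert K i)) → Clique G (suc s)
extend-clique {m} {s} {G} K w w~ = record { vert = vert′ ; inj = inj′ ; adjacent = adj′ }
  where
  vert′ : Fin (suc s) → Fin m
  vert′ zero    = w
  vert′ (suc i) = vert K i
  inj′ : Injective _≡_ _≡_ vert′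
  inj′ {zero} {zero} _ = refl
  inj′ {zero} {suc j} q = ⊥-elim (irrefl G (subst (Adj G w) (≡-sym q) (w~ j)))
  inj′ {suc i} {zero} q = ⊥-elim (irrefl G (subst (Adj G w) q (w~ i)))
  inj′ {suc i} {suc j} q = cong suc (inj K q)
  adj′ : ∀ i j → i ≢ j → Adj G (vert′ i) (vert′ j)
  adj′ zero zero n = ⊥-elim (n refl)
  adj′ zero (suc j) _ = w~ j
  adj′ (suc i) zero _ = sym G (w~ i)
  adj′ (suc i) (suc j) n = adjacent K i j (n ∘ cong suc)

-- The parent forest and the origin of illegal colours.

module Strategy {m : ℕ} (G : Graph m) (k : ℕ) (1≤k : 1 ≤ k) (small : ¬ Clique G (2 + k))
  (rank : Fin m → ℕ) (rank-injective : ∀ {u w} → rank u ≡ rank w → u ≡ w)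
  (lower-clique : ∀ {v u w} → Adj G v u → Adj G v w → rank u < rank v → rank w < rank v → u ≢ w → Adj G u w)
  where

  open import Data.List.Membership.DecPropositional (_≟_ {m}) using (_∈?_)

  V : Set
  V = Fin m

  Col : Set
  Col = Fin (3 + k)

  Lower : V → V → Set
  Lower v u = Adj G v u × rank u < rank v

  lower? : ∀ v u → Dec (Lower v u)
  lower? v u = adj? G v u ×-dec (rank u <? rank v)

  Parent : V → V → Set
  Parent u v = Lower u v × (∀ w → Lower u w → rank v ≤ rank w)

  parent? : ∀ u v → Dec (Parent u v)
  parent? u v = lower? u v ×-dec all? (λ w → lower? u w →-dec (rank v ≤? rank w))

  parent-unique : ∀ {u v w} → Parent u v → Parent u w → v ≡ w
  parent-unique (l , min) (l′ , min′) = rank-injective (ℕ.≤-antisym (min _ l′) (min′ _ l))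

  -- A sufficient condition for legality that inspects only lower neighbours and children of `v`,
  -- not cliques.
  Safe : Coloring m (3 + k) → V → Col → Set
  Safe c v a = ∀ u → c u ≡ just a → ¬ (Lower v u ⊎ Parent u v)

  -- The child `t` is the top vertex of `K`. A lower neighbour of `t` ranked beneath the bottom of
  -- `K` would, by `lower-clique`, be adjacent to all of `K`, contradicting `small`.
  bottom-is-parent : (K : Clique G (suc k)) (i : Fin (suc k)) → (∀ j → ¬ rank (vert K j) < rank (vert K i)) →
                     ∃ λ t → t ≢ i × Parent (vert K t) (vert K i)
  bottom-is-parent K i min with argmax (rank ∘ vert K)
  ... | t , max = t , t≢i , (below i (t≢i ∘ ≡-sym)) , λ w l → ≮⇒≥ (λ w<i → small (bigger w l w<i))
    where
    below : ∀ j → j ≢ t → Lower (vert K t) (vert K j)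
    below j j≢t = adjacent K t j (j≢t ∘ ≡-sym) , ≤∧≢⇒< (max j) (λ q → j≢t (inj K (rank-injective q)))

    other : ∀ {n} → 1 ≤ n → (i : Fin (suc n)) → ∃ λ j → j ≢ i
    other (s≤s _) i = punchIn i zero , punchInᵢ≢i i zero

    -- As k is at least 1, `K` has a second vertex. It lies below the top, so the top is not the
    -- bottom.
    t≢i : t ≢ i
    t≢i refl with other 1≤k t
    ... | j , j≢t = min j (proj₂ (below j j≢t))

    bigger : ∀ w → Lower (vert K t) w → rank w < rank (vert K i) → Clique G (2 + k)
    bigger w (t~w , w<t) w<i = extend-clique K w w~
      where
      w≢ : ∀ j → w ≢ vert K j
      w≢ j refl = min j w<i
      w~ : ∀ j → Adj G w (vert K j)
      w~ j with j ≟ t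
      ... | yes refl = sym G t~w
      ... | no j≢t with below j j≢t
      ...   | t~j , j<t = lower-clique t~w t~j w<t j<t (w≢ j)

  -- A new monochromatic clique contains `v`. Either it has a vertex below `v`, which is a lower
  -- neighbour, or `v` is its bottom and its top is a child of `v`; both have colour `a` already.
  safe⇒legal : ∀ {c v a} → c v ≡ nothing → ¬ MonoClique G k c → Safe c v a → LegalMove G k c v a
  safe⇒legal {c} {v} {a} cv mono safe = cv , contra
    where
    contra : ¬ MonoClique G k (update c v a)
    contra (K , b , h) with any? (λ i → vert K i ≟ v)
    ... | no v∉K = mono (K , b , λ i → trans (≡-sym (update-other c v a (λ q → v∉K (i , q)))) (h i))
    ... | yes (i , refl) with just-injective (trans (≡-sym (h i)) (update-same c v a))
    ...   | refl with any? (λ j → rank (vert K j) <? rank v)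
    ...     | yes (j , j<i) = safe (vert K j) (color j j≢i) (inj₁ (adjacent K i j (j≢i ∘ ≡-sym) , j<i))
      where
      j≢i : j ≢ i
      j≢i refl = <-irrefl refl j<i
      color : ∀ j → j ≢ i → c (vert K j) ≡ just a
      color j j≢i = trans (≡-sym (update-other c v a (λ q → j≢i (inj K q)))) (h j)
    ...     | no min with bottom-is-parent K i (λ j q → min (j , q))
    ...       | t , t≢i , par =
      safe (vert K t) (trans (≡-sym (update-other c v a (λ q → t≢i (inj K q)))) (h t)) (inj₂ par)

  -- Invariants of the activation strategy.

  -- Position during Alice's climb, with the cursor at x: all active vertices
  -- other than x have already been accounted for at their parents.
  record Climbing (c : Coloring m (3 + k)) (A : List V) (x : V) : Set where
    field
      colored-active : ∀ {u} → c u ≢ nothing → u ∈ A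
      closed         : ∀ {u v} → u ∈ A → u ≢ x → Parent u v → v ∈ A
      one-child      : ∀ {v u w} → c v ≡ nothing → u ∈ A → w ∈ A → u ≢ x → w ≢ x →
                       Parent u v → Parent w v → u ≡ w
      no-mono        : ¬ MonoClique G k c

  -- The invariant when Bob is to move: his next vertex can give an uncoloured vertex at most a
  -- second active child.
  record Stable (c : Coloring m (3 + k)) (A : List V) : Set where
    field
      colored-active : ∀ {u} → c u ≢ nothing → u ∈ A
      closed         : ∀ {u v} → u ∈ A → Parent u v → v ∈ A
      one-child      : ∀ {v u w} → c v ≡ nothing → u ∈ A → w ∈ A → Parent u v → Parent w v → u ≡ w
      no-mono        : ¬ MonoClique G k c

  stable⇒climbing : ∀ {c A} x → Stable c A → Climbing c A x
  stable⇒climbing x st = record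
    { colored-active = colored-active ; closed = λ u∈ _ → closed u∈
    ; one-child = λ cv u∈ w∈ _ _ → one-child cv u∈ w∈ ; no-mono = no-mono }
    where open Stable st

  just≢nothing : ∀ {y : Maybe Col} {a} → y ≡ just a → y ≢ nothing
  just≢nothing refl ()

  -- Counting the blocked colours.

  Blocker : Coloring m (3 + k) → V → Col → V → Set
  Blocker c v a u = c u ≡ just a × (Lower v u ⊎ Parent u v)

  blocker? : ∀ c v a u → Dec (Blocker c v a u)
  blocker? c v a u = ≡-dec _≟_ (c u) (just a) ×-dec (lower? v u ⊎-dec parent? u v)

  -- Suppose every colour is blocked. Coloured children are active, so at most two colours are
  -- blocked by children (`x` and one more). At least k + 1 colours then come from distinct lower
  -- neighbours, which together with `v` form a clique on k + 2 vertices.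
  safe-exists : ∀ {c A x v} → Climbing c A x → c v ≡ nothing → ∃ (Safe c v)
  safe-exists {c} {A} {x} {v} cl cv with any? (λ a → ¬? (any? (blocker? c v a)))
  ... | yes (a , free) = a , λ u cu q → free (u , cu , q)
  ... | no none = ⊥-elim (small (extend-clique K v (λ i → proj₁ (proj₂ (proj₂ (low i))))))
    where
    open Climbing cl

    Q P : Col → Set
    Q a = ∃ λ u → c u ≡ just a × Lower v u
    P a = ∃ λ u → c u ≡ just a × Parent u v

    blocked : ∀ a → Q a ⊎ P a
    blocked a with any? (blocker? c v a)
    ... | yes (u , cu , inj₁ l) = inj₁ (u , cu , l)
    ... | yes (u , cu , inj₂ p) = inj₂ (u , cu , p)
    ... | no free = ⊥-elim (none (a , free))

    differ : ∀ {a b u w} → a ≢ b → c u ≡ just a → c w ≡ just b → u ≢ w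
    differ a≢b cu cw refl = a≢b (just-injective (trans (≡-sym cu) cw))

    clash : ∀ {a b} → a ≢ b → ((u , _) : P a) → ((w , _) : P b) → u ≢ x → w ≢ x → ⊥
    clash a≢b (u , cu , pu) (w , cw , pw) u≢x w≢x = differ a≢b cu cw
      (one-child cv (colored-active (just≢nothing cu)) (colored-active (just≢nothing cw)) u≢x w≢x pu pw)

    few : ∀ a b d → a ≢ b → a ≢ d → b ≢ d → P a → P b → P d → ⊥
    -- Distinct colours mean distinct children. At most one of the three is `x`, and the other two
    -- violate `one-child`.
    few a b d a≢b a≢d b≢d pa@(u , cu , _) pb@(w , cw , _) pd@(z , cz , _) with u ≟ x | w ≟ x
    ... | no u≢x | no w≢x = clash a≢b pa pb u≢x w≢x
    ... | yes refl | _ = clash b≢d pb pd (differ a≢b cu cw ∘ ≡-sym) (differ a≢d cu cz ∘ ≡-sym)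
    ... | no u≢x | yes refl = clash a≢d pa pd u≢x (differ b≢d cw cz ∘ ≡-sym)

    -- The k + 3 colours are read as 2 + (k + 1), leaving k + 1 after the two discards.
    selected = select blocked few
    low      = proj₂ (proj₂ selected)

    u≢ : ∀ i j → i ≢ j → proj₁ (low i) ≢ proj₁ (low j)
    u≢ i j i≢j = differ (λ q → i≢j (proj₁ (proj₂ selected) q)) (proj₁ (proj₂ (low i))) (proj₁ (proj₂ (low j)))

    K : Clique G (suc k)
    K = record
      { vert = λ i → proj₁ (low i)
      ; inj = λ {i} {j} q → decide i j q
      ; adjacent = λ i j i≢j → let (_ , _ , v~i , i<v) = low i ; (_ , _ , v~j , j<v) = low j in
                     lower-clique v~i v~j i<v j<v (u≢ i j i≢j) }
      where
      decide : ∀ i j → proj₁ (low i) ≡ proj₁ (low j) → i ≡ j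
      decide i j q with i ≟ j
      ... | yes r = r
      ... | no n  = ⊥-elim (u≢ i j n q)

  legal-exists : ∀ {c A x v} → Climbing c A x → c v ≡ nothing → ∃ (LegalMove G k c v)
  legal-exists cl cv with safe-exists cl cv
  ... | a , safe = a , safe⇒legal cv (Climbing.no-mono cl) safe

  -- Bob's move and Alice's reply.

  uncolored? : ∀ (c : Coloring m (3 + k)) u → Dec (c u ≡ nothing)
  uncolored? c u = ≡-dec _≟_ (c u) nothing

  -- The only newly active vertex is `x`, exactly the one that `Climbing` exempts.
  bobMoves : ∀ {c A x a} → Stable c A → LegalMove G k c x a → Climbing (update c x a) (x ∷ A) x
  bobMoves {c} {A} {x} {a} st (_ , ok) = record
    { colored-active = active ; closed = λ u∈ u≢x p → there (closed (tail u≢x u∈) p)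
    ; one-child = λ cv u∈ w∈ u≢x w≢x →
        one-child (proj₂ (update-uncolored c x a cv)) (tail u≢x u∈) (tail w≢x w∈)
    ; no-mono = ok }
    where
    open Stable st
    active : ∀ {u} → update c x a u ≢ nothing → u ∈ x ∷ A
    active {u} cu with u ≟ x
    ... | yes q = here q
    ... | no _  = there (colored-active cu)

  AliceReply : Coloring m (3 + k) → Set
  AliceReply c = ∃ λ v → ∃ λ a → LegalMove G k c v a × ∃ (Stable (update c v a))

  -- Colouring a vertex whose parent is coloured creates no new active child.
  freeMove : ∀ {c A} → Stable c A → ∀ v → c v ≡ nothing → Acc _<_ (rank v) → AliceReply c
  freeMove {c} {A} st v cv (acc rec) with any? (λ p → parent? v p ×-dec uncolored? c p)
  ... | yes (p , par , cp) = freeMove st p cp (rec (proj₂ (proj₁ par)))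
  ... | no top with legal-exists (stable⇒climbing v st) cv
  ...   | a , legal = v , a , legal , v ∷ A , record
    { colored-active = Climbing.colored-active cl ; closed = closed′ ; one-child = one ; no-mono = proj₂ legal }
    where
    cl = bobMoves st legal
    closed′ : ∀ {u w} → u ∈ v ∷ A → Parent u w → w ∈ v ∷ A
    closed′ (here refl) p = there (Stable.colored-active st (λ cw → top (_ , p , cw)))
    closed′ (there u∈) p  = there (Stable.closed st u∈ p)
    one : ∀ {w u z} → update c v a w ≡ nothing → u ∈ v ∷ A → z ∈ v ∷ A → Parent u w → Parent z w → u ≡ z
    one {w} cw u∈ z∈ pu pz = Climbing.one-child cl cw u∈ z∈ (not-v pu) (not-v pz) pu pz
      where
      not-v : ∀ {u} → Parent u w → u ≢ v
      not-v p refl = top (_ , p , proj₂ (update-uncolored c v a cw))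

  -- If `x` has no uncoloured parent, the exemption of `x` is vacuous and a free move starting from
  -- `v` suffices. An inactive uncoloured parent is activated and becomes the cursor; an active one
  -- is coloured, which removes it from the count. The rank of the cursor falls at each step.
  climb : ∀ {c A x} → Climbing c A x → ∀ v → c v ≡ nothing → Acc _<_ (rank x) → AliceReply c
  climb {c} {A} {x} cl v cv (acc rec) with any? (λ p → parent? x p ×-dec uncolored? c p)
  ... | no top = freeMove stable v cv (<-wellFounded _)
    where
    open Climbing cl
    closed′ : ∀ {u w} → u ∈ A → Parent u w → w ∈ A
    closed′ {u} u∈ p with u ≟ x
    ... | yes refl = colored-active (λ cw → top (_ , p , cw))
    ... | no u≢x   = closed u∈ u≢x p
    not-x : ∀ {u w} → c w ≡ nothing → Parent u w → u ≢ x
    not-x cw p refl = top (_ , p , cw)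
    stable : Stable c A
    stable = record
      { colored-active = colored-active ; closed = closed′
      ; one-child = λ cw u∈ z∈ pu pz → one-child cw u∈ z∈ (not-x cw pu) (not-x cw pz) pu pz
      ; no-mono = no-mono }
  ... | yes (p , par , cp) with p ∈? A
  ...   | no p∉A = climb cl′ v cv (rec (proj₂ (proj₁ par)))
    where
    open Climbing cl
    closed′ : ∀ {u w} → u ∈ p ∷ A → u ≢ p → Parent u w → w ∈ p ∷ A
    closed′ {u} u∈ u≢p q with u ≟ x
    ... | yes refl = here (parent-unique q par)
    ... | no u≢x   = there (closed (tail u≢p u∈) u≢x q)
    -- Any other active child of `p` would already have made `p` active by closure.
    only-x : ∀ {u} → u ∈ A → Parent u p → u ≡ x
    only-x {u} u∈ q with u ≟ x
    ... | yes r  = r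
    ... | no u≢x = ⊥-elim (p∉A (closed u∈ u≢x q))
    one : ∀ {w u z} → c w ≡ nothing → u ∈ p ∷ A → z ∈ p ∷ A → u ≢ p → z ≢ p → Parent u w → Parent z w → u ≡ z
    one {w} cw u∈ z∈ u≢p z≢p pu pz with w ≟ p
    ... | yes refl = trans (only-x (tail u≢p u∈) pu) (≡-sym (only-x (tail z≢p z∈) pz))
    ... | no w≢p   = one-child cw (tail u≢p u∈) (tail z≢p z∈) (not-x pu) (not-x pz) pu pz
      where
      not-x : ∀ {u} → Parent u w → u ≢ x
      not-x q refl = w≢p (parent-unique q par)
    cl′ : Climbing c (p ∷ A) p
    cl′ = record
      { colored-active = there ∘ colored-active ; closed = closed′ ; one-child = one ; no-mono = no-mono }
  ...   | yes p∈A with legal-exists cl cp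
  ...     | a , legal = p , a , legal , A , record
    { colored-active = active ; closed = closed′ ; one-child = one ; no-mono = proj₂ legal }
    where
    open Climbing cl
    active : ∀ {u} → update c p a u ≢ nothing → u ∈ A
    active {u} cu with u ≟ p
    ... | yes refl = p∈A
    ... | no _     = colored-active cu
    closed′ : ∀ {u w} → u ∈ A → Parent u w → w ∈ A
    closed′ {u} u∈ q with u ≟ x
    ... | yes refl = subst (_∈ A) (parent-unique par q) p∈A
    ... | no u≢x   = closed u∈ u≢x q
    one : ∀ {w u z} → update c p a w ≡ nothing → u ∈ A → z ∈ A → Parent u w → Parent z w → u ≡ z
    one {w} cw u∈ z∈ pu pz with update-uncolored c p a cw
    ... | w≢p , cw′ = one-child cw′ u∈ z∈ (not-x pu) (not-x pz) pu pz
      where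
      -- The only parent of `x` is `p`, now coloured, so `x` is a child of no uncoloured vertex.
      not-x : ∀ {u} → Parent u w → u ≢ x
      not-x q refl = w≢p (parent-unique q par)

  -- Playing the game to its end.

  Covers : List V → Coloring m (3 + k) → Set
  Covers L c = ∀ u → c u ≡ nothing → u ∈ L

  without : V → List V → List V
  without v = filter (λ u → ¬? (u ≟ v))

  covers-update : ∀ {L c} v a → Covers L c → Covers (without v L) (update c v a)
  covers-update {c = c} v a cov u cu with update-uncolored c v a cu
  ... | u≢v , cu′ = ∈-filter⁺ _ (cov u cu′) u≢v

  without-shorter : ∀ {v} L → v ∈ L → length (without v L) < length L
  without-shorter L v∈ = filter-notAll _ L (lose v∈ (λ v≢v → v≢v refl))

  mutual
    -- `L` contains all uncoloured vertices and loses the one just coloured, so its length bounds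
    -- the remaining play. The two invariants alternate with the player to move.
    aliceWins : ∀ {c A x} L → Acc _<_ (length L) → Covers L c → Climbing c A x → AliceWins G k (3 + k) alice c
    aliceWins {c} L (acc rec) cov cl with any? (uncolored? c)
    ... | no done = finished λ v q → done (v , q)
    ... | yes (v , cv) with climb cl v cv (<-wellFounded _)
    ...   | w , a , legal , _ , st = aliceMove (λ _ → legal-exists cl) w a legal
      (bobLoses (without w L) (rec (without-shorter L (cov w (proj₁ legal)))) (covers-update w a cov) st)

    bobLoses : ∀ {c A} L → Acc _<_ (length L) → Covers L c → Stable c A → AliceWins G k (3 + k) bob c
    bobLoses L (acc rec) cov st = bobMove (λ v → legal-exists (stable⇒climbing v st)) λ v a legal →
      aliceWins (without v L) (rec (without-shorter L (cov v (proj₁ legal)))) (covers-update v a cov) (bobMoves st legal)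

  empty-stable : Stable emptyColoring []
  empty-stable = record
    { colored-active = λ n → ⊥-elim (n refl) ; closed = λ () ; one-child = λ _ ()
    ; no-mono = λ { (_ , _ , h) → just≢nothing (h zero) refl } }

  alice-wins-game : V → AliceWinsGame G k (3 + k)
  -- Bob has not moved yet, so the cursor is an arbitrary vertex.
  alice-wins-game v = aliceWins (allFin m) (<-wellFounded _) (λ u _ → ∈-allFin u) (stable⇒climbing v empty-stable)

theorem3p4 : (k : ℕ) → 1 ≤ k → {m : ℕ} → (H : Graph m) →
    Chordal H → CliqueNumber H (k + 1) → GameChromLe H k (k + 3)
theorem3p4 k 1≤k {m} H chordal (K , largest) = 3 + k , ≤-reflexive (+-comm 3 k) , alice-wins-game (vertex (+-comm k 1))
  where
  open Elimination.Ranking (Elimination.ranking H chordal (allFin m) (<-wellFounded _))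
  -- The clique on k + 1 vertices is nonempty and so supplies the initial cursor.
  vertex : ∀ {s} → k + 1 ≡ suc s → Fin m
  vertex q = vert (subst (Clique H) q K) zero
  small : ¬ Clique H (2 + k)
  small K′ = <-irrefl (+-comm 1 k) (largest _ K′)
  open Strategy H k 1≤k small rank (distinct (∈-allFin _) (∈-allFin _))
    (lower-clique (∈-allFin _) (∈-allFin _) (∈-allFin _))
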